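{- The graph of curvatures of any tight trihex is a complete graph on 4 vertices.
   Context: A trihex is a finite, connected, 3-regular planar graph, drawn in the plane (regarded as part of the sphere), whose faces (including the unbounded one) all have three or six sides. Faces with three (six) sides are called triangles (hexagons). Every trihex has exactly four triangular faces (by Euler's formula). A belt is a circuit of distinct hexagonal faces in a trihex such that each hexagon is adjacent to its neighbors in the circuit on opposite edges. A trihex is tight if it does not contain any belts. A pseudo-road connecting triangular faces $c$ and $d$ is a sequence of hexagonal faces $a_1,\dots,a_\ell$ ($\ell\ge 0$) such that, setting $a_0=c$ and $a_{\ell+1}=d$, for $1\le i\le \ell$ the face $a_i$ is adjacent to $a_{i-1}$ and $a_{i+1}$ on opposite edges; that is, there are edges $e_0,\dots,e_\ell$ such that $e_i$ is shared by $a_i$ and $a_{i+1}$ for $0\le i\le \ell$, and $e_{i-1}$ and $e_i$ are opposite edges of the hexagon $a_i$ for $1\le i\le\ell$. (When $\ell=0$ this means that $c$ and $d$ share an edge.) The graph of curvatures of a trihex is the graph whose vertices are the four triangular faces, two vertices $c$ and $d$ being connected by an edge if there exists a pseudo-road connecting the faces $c$ and $d$. -}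

module Defs where

open import Data.Fin using (Fin; zero; suc; inject₁; fromℕ)
open import Data.Fin.Permutation using (Permutation′; _⟨$⟩ʳ_)
open import Data.Fin.Properties using (_≟_)
open import Data.List using (length; filter; allFin)
open import Data.Nat using (ℕ; suc; _+_)
open import Data.Nat.GeneralisedArithmetic using (iterate)
open import Data.Product using (Σ; ∃; _×_; proj₁)
open import Data.Sum using (_⊎_)
open import Function using (_↔_; _⇔_; Inverse)
open import Function.Definitions using (Injective; StrictlySurjective)
open import Relation.Binary.Construct.Closure.ReflexiveTransitive using (Star)
open import Relation.Binary.PropositionalEquality using (_≡_; _≢_)
open import Relation.Nullary using (¬_)

SameOrbit : ∀ {n} → (Fin n → Fin n) → Fin n → Fin n → Set
SameOrbit f x y = ∃ λ k → iterate f x k ≡ y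

-- π presents Fin m as the set of orbits of f.
record IsOrbitMap {n m} (f : Fin n → Fin n) (π : Fin n → Fin m) : Set where
  field
    surjective : StrictlySurjective _≡_ π
    orbits     : ∀ x y → π x ≡ π y ⇔ SameOrbit f x y

fibreSize : ∀ {n m} → (Fin n → Fin m) → Fin m → ℕ
fibreSize {n} π y = length (filter (λ x → π x ≟ y) (allFin n))

-- A finite graph cellularly embedded in an oriented closed surface, given as a
-- combinatorial map.  A dart is an edge with a direction; α reverses a dart,
-- and σ sends a dart to the clockwise next dart with the same tail.  Walking
-- along d and then taking σ (α d) keeps the face to the left of d on the left,
-- so faces are the orbits of φ = σ ∘ α.  Each dart is thus one side of the
-- face to its left, and α d is the same edge as a side of the face across it.
record CombinatorialMap : Set where
  field
    #darts #vertices #edges #faces : ℕ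

  Dart   = Fin #darts
  Vertex = Fin #vertices
  Edge   = Fin #edges
  Face   = Fin #faces

  field
    rotation     : Permutation′ #darts
    α            : Dart → Dart
    α-involutive : ∀ d → α (α d) ≡ d
    α-no-fixed   : ∀ d → α d ≢ d

  σ : Dart → Dart
  σ d = rotation ⟨$⟩ʳ d

  φ : Dart → Dart
  φ d = σ (α d)

  field
    tail : Dart → Vertex
    edge : Dart → Edge
    face : Dart → Face
    tail-orbits : IsOrbitMap σ tail
    edge-orbits : IsOrbitMap α edge
    face-orbits : IsOrbitMap φ face

  Adjacent : Vertex → Vertex → Set
  Adjacent v w = ∃ λ d → tail d ≡ v × tail (α d) ≡ w

  Connected : Set
  Connected = ∀ v w → Star Adjacent v w

  -- For a connected map, Euler's formula says that the surface is the sphere.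
  Planar : Set
  Planar = #vertices + #faces ≡ #edges + 2

  degree : Vertex → ℕ
  degree = fibreSize tail

  sides : Face → ℕ
  sides = fibreSize face

  IsTriangle : Face → Set
  IsTriangle f = sides f ≡ 3

  IsHexagon : Face → Set
  IsHexagon f = sides f ≡ 6

record Trihex : Set where
  field
    map : CombinatorialMap

  open CombinatorialMap map public

  field
    connected          : Connected
    planar             : Planar
    cubic              : ∀ v → degree v ≡ 3
    triangle-or-hexagon : ∀ f → IsTriangle f ⊎ IsHexagon f

module _ (T : Trihex) where
  open Trihex T

  -- The opposite side, when d is a side of a hexagon.
  opposite : Dart → Dart
  opposite d = φ (φ (φ d))

  -- Crossing d from the face on its left leads into the face of α d; that face
  -- is a hexagon and d′ is its side opposite to the one just crossed.
  Straight : Dart → Dart → Set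
  Straight d d′ = IsHexagon (face (α d)) × d′ ≡ opposite (α d)

  -- The faces face (e 0), …, face (e n) are the hexagons of the belt, and the
  -- edge of e i is the one through which the circuit leaves face (e i).
  record Belt : Set where
    field
      n        : ℕ
      e        : Fin (suc n) → Dart
      distinct : Injective _≡_ _≡_ (λ i → face (e i))
      steps    : ∀ (i : Fin n) → Straight (e (inject₁ i)) (e (suc i))
      closes   : Straight (e (fromℕ n)) (e zero)

  Tight : Set
  Tight = ¬ Belt

  -- e i is the edge e_i as a side of a_i, so that a_i = face (e i) for i ≤ ℓ
  -- and a_{ℓ+1} = face (α (e ℓ)).
  record PseudoRoad (c d : Face) : Set where
    field
      ℓ      : ℕ
      e      : Fin (suc ℓ) → Dart
      starts : face (e zero) ≡ c
      ends   : face (α (e (fromℕ ℓ))) ≡ d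
      steps  : ∀ (i : Fin ℓ) → Straight (e (inject₁ i)) (e (suc i))

record Graph : Set₁ where
  field
    Vertex : Set
    Adj    : Vertex → Vertex → Set

complete : ℕ → Graph
complete n = record { Vertex = Fin n ; Adj = _≢_ }

infix 4 _≅_

record _≅_ (G H : Graph) : Set where
  private
    module G = Graph G
    module H = Graph H
  field
    bijection : G.Vertex ↔ H.Vertex
    adjacency : ∀ x y → G.Adj x y ⇔ H.Adj (Inverse.to bijection x) (Inverse.to bijection y)

curvatureGraph : Trihex → Graph
curvatureGraph T = record
  { Vertex = Σ Face IsTriangle
  ; Adj    = λ c d → PseudoRoad T (proj₁ c) (proj₁ d)
  }
  where open Trihex T

{-# OPTIONS --safe #-}

-- By cubicity and the face sizes, α and σ act on the darts through the group of
-- rotations and translations of the hexagonal tiling.  In that group s = φ³ ∘ α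
-- is a unit translation, so pseudo-roads and belts are orbits of s, and the darts
-- of triangles are the fixed points of the half-turn ψ = φ³.  Half-turns about
-- edges and rotations by π/3 and 2π/3 fix no dart, so an s-orbit that misses every
-- triangle is a belt.  In a tight trihex every line of translates thus meets a
-- triangle, which forces the three pseudo-roads leaving a triangle to have the same
-- length N.  If u₀ + u₂ + u₄ = 0 are the unit translations along them, the N uᵢ are
-- then distinct non-zero half-periods, so the roads end at three distinct further
-- triangles, and Euler's formula leaves room for no others.
module Submission where

open import Defs

open import Data.Nat.Properties as ℕ
open import Algebra.Properties.Semiring.Sum +-*-semiring
  using (sum; sum-cong-≗; sum-replicate-zero; ∑-distrib-+; ∑-comm; *-distribˡ-sum)
open import Data.Bool using (if_then_else_)
open import Data.Empty using (⊥)
open import Data.Fin using (Fin; zero; suc; toℕ; fromℕ; fromℕ<; inject₁)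
open import Data.Fin.Permutation using (inverseˡ; _⟨$⟩ˡ_)
open import Data.Fin.Properties as Fin
  using (pigeonhole; injective⇒≤; toℕ-injective; toℕ<n; toℕ-fromℕ<; toℕ-fromℕ; toℕ-inject₁)
open import Data.List using (List; []; _∷_; length; filter; allFin; tabulate; lookup)
open import Data.List.Membership.Propositional using (_∈_)
open import Data.List.Membership.Propositional.Properties
  using (∈-allFin; ∈-lookup; ∈-filter⁺; ∈-filter⁻; ∈-tabulate⁺; ∈-tabulate⁻)
open import Data.List.Membership.Propositional.Properties.WithK using (unique∧set⇒bag)
open import Data.List.Membership.Setoid.Properties using (index-injective)
open import Data.List.Properties using (length-tabulate)
open import Data.List.Relation.Binary.BagAndSetEquality using (∼bag⇒↭)
open import Data.List.Relation.Binary.Permutation.Propositional.Properties using (↭-length)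
open import Data.List.Relation.Unary.All as All using (All; []; _∷_)
open import Data.List.Relation.Unary.All.Properties using (¬Any⇒All¬)
open import Data.List.Relation.Unary.AllPairs using ([]; _∷_)
open import Data.List.Relation.Unary.Any using (here; there; index; any?)
open import Data.List.Relation.Unary.Any.Properties using (lookup-index)
open import Data.List.Relation.Unary.Unique.Propositional using (Unique)
open import Data.List.Relation.Unary.Unique.Propositional.Properties using (allFin⁺; filter⁺; tabulate⁺)
open import Data.Nat hiding (_≟_)
open import Data.Nat.DivMod using (_%_; _/_; m%n<n; m≡m%n+[m/n]*n)
open import Data.Nat.GeneralisedArithmetic using (iterate)
open import Data.Product using (Σ; ∃; _×_; _,_; proj₁; proj₂)
open import Data.Sum using (_⊎_; inj₁; inj₂; fromInj₁; fromInj₂)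
open import Function using (_∘_; id; mk⇔; _↔_; mk↔ₛ′; Equivalence; Injection; Inverse)
open import Function.Definitions using (Injective)
open import Function.Properties.Inverse using (↔⇒↣)
open import Relation.Binary.Definitions using (tri<; tri≈; tri>)
open import Relation.Binary.PropositionalEquality
open import Relation.Nullary using (¬_; Dec; does; yes; no; contradiction)
open import Relation.Unary using (Decidable; Irrelevant)
open ≡-Reasoning

-- Least witnesses and iterates of a map.

IsLeast : (ℕ → Set) → ℕ → Set
IsLeast P n = P n × (∀ {j} → j < n → ¬ P j)

least : {P : ℕ → Set} → Decidable P → ∀ {n} → P n → ∃ (IsLeast P)
least P? {n} pn with P? 0
least P? {n} pn | yes p₀ = 0 , p₀ , λ ()
least P? {zero} pn | no ¬p₀ = contradiction pn ¬p₀
least P? {suc n} pn | no ¬p₀ with least (P? ∘ suc) pn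
... | m , pm , below = suc m , pm , λ { {zero} _ → ¬p₀ ; {suc j} (s≤s j<m) → below j<m }

module _ {A : Set} where

  iterate-+ : ∀ (f : A → A) x m n → iterate f x (m + n) ≡ iterate f (iterate f x m) n
  iterate-+ f x zero n = refl
  iterate-+ f x (suc m) n = iterate-+ f (f x) m n

  iterate-natural : {f g h : A → A} → (∀ x → h (f x) ≡ g (h x)) →
                    ∀ k x → h (iterate f x k) ≡ iterate g (h x) k
  iterate-natural comm zero x = refl
  iterate-natural {f} {g} comm (suc k) x =
    trans (iterate-natural comm k (f x)) (cong (λ y → iterate g y k) (comm x))

  iterate-suc : ∀ (f : A → A) x k → iterate f x (suc k) ≡ f (iterate f x k)
  iterate-suc f x k = sym (iterate-natural {f = f} {h = f} (λ _ → refl) k x)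

  iterate-inverse : {f g : A → A} → (∀ x → g (f x) ≡ x) →
                    ∀ k x → iterate g (iterate f x k) k ≡ x
  iterate-inverse inv zero x = refl
  iterate-inverse {f} {g} inv (suc k) x = begin
    iterate g (g (iterate f x (suc k))) k ≡⟨ cong (λ y → iterate g (g y) k) (iterate-suc f x k) ⟩
    iterate g (g (f (iterate f x k))) k   ≡⟨ cong (λ y → iterate g y k) (inv _) ⟩
    iterate g (iterate f x k) k           ≡⟨ iterate-inverse inv k x ⟩
    x                                     ∎

  iterate-* : ∀ {f : A → A} {x p} → iterate f x p ≡ x → ∀ k → iterate f x (k * p) ≡ x
  iterate-* eq zero = refl
  iterate-* {f} {x} {p} eq (suc k) = begin
    iterate f x (p + k * p)         ≡⟨ iterate-+ f x p (k * p) ⟩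
    iterate f (iterate f x p) (k * p) ≡⟨ cong (λ y → iterate f y (k * p)) eq ⟩
    iterate f x (k * p)             ≡⟨ iterate-* eq k ⟩
    x                               ∎

  iterate-double : ∀ (f : A → A) x n → iterate f x (n + n) ≡ iterate (f ∘ f) x n
  iterate-double f x zero = refl
  iterate-double f x (suc n) = trans (cong (iterate f (f x)) (+-suc n n)) (iterate-double f (f (f x)) n)

  -- The hypotheses make `f` and `g` commute with product `h`. The case of interest is `s` and
  -- `translate 2`, with product `translate 1`.
  commuting-iterate : {f g h : A → A} → (∀ x → f (g x) ≡ h x) → (∀ x → g (f x) ≡ h x) →
                      ∀ k x → iterate g (iterate f x k) k ≡ iterate h x k
  commuting-iterate fg gf zero x = refl
  commuting-iterate {f} {g} {h} fg gf (suc k) x = begin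
    iterate g (g (iterate f (f x) k)) k
      ≡⟨ cong (λ y → iterate g y k) (iterate-natural {h = g} (λ y → trans (gf y) (sym (fg y))) k (f x)) ⟩
    iterate g (iterate f (g (f x)) k) k ≡⟨ commuting-iterate fg gf k (g (f x)) ⟩
    iterate h (g (f x)) k               ≡⟨ cong (λ y → iterate h y k) (gf x) ⟩
    iterate h (h x) k                   ∎

  iterate-injective : {f : A → A} → Injective _≡_ _≡_ f → ∀ k → Injective _≡_ _≡_ (λ x → iterate f x k)
  iterate-injective inj zero eq = eq
  iterate-injective inj (suc k) eq = inj (iterate-injective inj k eq)

  iterate-cancel : {f : A → A} → Injective _≡_ _≡_ f → ∀ {x i j} →
                   iterate f x i ≡ iterate f x (i + j) → iterate f x j ≡ x
  iterate-cancel {f} inj {x} {i} {j} eq = iterate-injective inj i (begin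
    iterate f (iterate f x j) i ≡⟨ iterate-+ f x j i ⟨
    iterate f x (j + i)         ≡⟨ cong (iterate f x) (+-comm j i) ⟩
    iterate f x (i + j)         ≡⟨ eq ⟨
    iterate f x i               ∎)

  -- The orbit of x under f has suc p elements.
  HasPeriod : (A → A) → A → ℕ → Set
  HasPeriod f x = IsLeast (λ j → iterate f x (suc j) ≡ x)

  iterate-distinct : ∀ {f : A → A} {x p} → Injective _≡_ _≡_ f → HasPeriod f x p →
                     ∀ {i j} → i < j → j < suc p → iterate f x i ≢ iterate f x j
  iterate-distinct inj (_ , below) {i} i<j (s≤s j≤p) eq with m≤n⇒∃[o]m+o≡n i<j
  ... | o , refl = below (≤-trans (s≤s (m≤n+m o i)) j≤p)
                         (iterate-cancel inj {i = i} (trans eq (cong (iterate _ _) (sym (+-suc i o)))))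

  iterate-mod : ∀ {f : A → A} {x p} → HasPeriod f x p → ∀ k →
                iterate f x k ≡ iterate f x (k % suc p)
  iterate-mod {f} {x} {p} (eq , _) k = begin
    iterate f x k
      ≡⟨ cong (iterate f x) (trans (m≡m%n+[m/n]*n k (suc p)) (+-comm (k % suc p) _)) ⟩
    iterate f x (k / suc p * suc p + k % suc p)   ≡⟨ iterate-+ f x (k / suc p * suc p) (k % suc p) ⟩
    iterate f (iterate f x (k / suc p * suc p)) (k % suc p)
      ≡⟨ cong (λ y → iterate f y (k % suc p)) (iterate-* {f} eq (k / suc p)) ⟩
    iterate f x (k % suc p)                       ∎

-- Orbits of injective maps on finite sets.

-- Among `n + 1` iterates two coincide; cancelling the common part by injectivity gives a return to
-- `x`, hence a least one.
period : ∀ {n} {f : Fin n → Fin n} → Injective _≡_ _≡_ f → ∀ x → ∃ (HasPeriod f x)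
period {n} {f} inj x with pigeonhole (n<1+n n) (λ i → iterate f x (toℕ i))
... | i , j , i<j , eq with m≤n⇒∃[o]m+o≡n i<j
... | o , si+o≡j = least (λ k → iterate f x (suc k) Fin.≟ x) {o}
        (iterate-cancel inj {i = toℕ i} (trans eq (cong (iterate f x) (trans (sym si+o≡j) (sym (+-suc (toℕ i) o))))))

iterate-returns : ∀ {n} {f : Fin n → Fin n} → Injective _≡_ _≡_ f →
                  ∀ k x → ∃ λ l → iterate f (iterate f x k) l ≡ x
iterate-returns {f = f} inj k x with period inj x
-- The orbit has `suc p` elements, so `k * p` further steps complete `k` full turns.
... | p , eq , _ = k * p , (begin
  iterate f (iterate f x k) (k * p)  ≡⟨ iterate-+ f x k (k * p) ⟨
  iterate f x (k + k * p)            ≡⟨ cong (iterate f x) (*-suc k p) ⟨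
  iterate f x (k * suc p)            ≡⟨ iterate-* {f = f} eq k ⟩
  x                                  ∎)

first-return : ∀ {n} {f : Fin n → Fin n} {P : Fin n → Set} → Injective _≡_ _≡_ f → Decidable P →
               ∀ {x} → P x → ∃ (IsLeast (λ k → P (iterate f x (suc k))))
first-return {f = f} {P} inj P? {x} px with period inj x
... | p , eq , _ = least (λ k → P? (iterate f x (suc k))) {p} (subst P (sym eq) px)

-- Iterates depend only on the exponent modulo the period, so testing one period decides the whole
-- orbit.
orbit-meets? : ∀ {n} {f : Fin n → Fin n} {P : Fin n → Set} → Injective _≡_ _≡_ f → Decidable P →
               ∀ x → (∃ λ k → P (iterate f x k)) ⊎ (∀ k → ¬ P (iterate f x k))
orbit-meets? {f = f} {P} inj P? x with period inj x
... | p , per with Fin.any? {n = suc p} (λ i → P? (iterate f x (toℕ i)))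
... | yes (i , pi) = inj₁ (toℕ i , pi)
... | no ¬any = inj₂ λ k pk → ¬any (fromℕ< (m%n<n k (suc p)) , subst P
      (trans (iterate-mod {f = f} per k) (cong (iterate f x) (sym (toℕ-fromℕ< (m%n<n k (suc p)))))) pk)

-- The fibre and the list of the first `suc p` iterates are both free of repetitions and have the
-- same members, so they are permutations of each other.
fibreSize-period : ∀ {n m} {f : Fin n → Fin n} {π : Fin n → Fin m} → IsOrbitMap f π →
                   Injective _≡_ _≡_ f → ∀ {x p} → HasPeriod f x p → fibreSize π (π x) ≡ suc p
fibreSize-period {n} {f = f} {π} isOrbitMap inj {x} {p} per = begin
  length fibre             ≡⟨ ↭-length (∼bag⇒↭ (unique∧set⇒bag
                                (filter⁺ inFibre? (allFin⁺ n)) (tabulate⁺ orbit-injective) (mk⇔ to from))) ⟩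
  length (tabulate orbit)  ≡⟨ length-tabulate orbit ⟩
  suc p                    ∎
  where
  open IsOrbitMap isOrbitMap
  inFibre? = λ y → π y Fin.≟ π x
  fibre = filter inFibre? (allFin n)

  orbit : Fin (suc p) → Fin n
  orbit i = iterate f x (toℕ i)

  orbit-injective : Injective _≡_ _≡_ orbit
  orbit-injective {i} {j} eq with <-cmp (toℕ i) (toℕ j)
  ... | tri< i<j _ _ = contradiction eq (iterate-distinct inj per i<j (toℕ<n j))
  ... | tri≈ _ i≡j _ = toℕ-injective i≡j
  ... | tri> _ _ j<i = contradiction (sym eq) (iterate-distinct inj per j<i (toℕ<n i))

  to : ∀ {y} → y ∈ fibre → y ∈ tabulate orbit
  to {y} y∈fibre with Equivalence.to (orbits x y) (sym (proj₂ (∈-filter⁻ inFibre? {xs = allFin n} y∈fibre)))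
  ... | k , eq = subst (_∈ tabulate orbit) (begin
    iterate f x (toℕ (fromℕ< (m%n<n k (suc p)))) ≡⟨ cong (iterate f x) (toℕ-fromℕ< (m%n<n k (suc p))) ⟩
    iterate f x (k % suc p)                      ≡⟨ iterate-mod per k ⟨
    iterate f x k                                ≡⟨ eq ⟩
    y                                            ∎) (∈-tabulate⁺ {f = orbit} (fromℕ< (m%n<n k (suc p))))

  from : ∀ {y} → y ∈ tabulate orbit → y ∈ fibre
  from y∈orbit with ∈-tabulate⁻ {f = orbit} y∈orbit
  ... | i , refl = ∈-filter⁺ inFibre? (∈-allFin _) (sym (Equivalence.from (orbits x _) (toℕ i , refl)))

-- Darts acted on by the orientation-preserving symmetries of the hexagonal
-- tiling: translate 0, …, translate 5 are its six unit translations.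
module Hexagonal {A : Set} (α σ : A → A)
  (α² : ∀ x → α (α x) ≡ x) (σ³ : ∀ x → σ (σ (σ x)) ≡ x)
  (φ⁶ : ∀ x → iterate (λ y → σ (α y)) x 6 ≡ x)
  (α-free : ∀ x → α x ≢ x) (σ-free : ∀ x → σ x ≢ x)
  (φ-free : ∀ x → σ (α x) ≢ x) (φ²-free : ∀ x → iterate (λ y → σ (α y)) x 2 ≢ x) where

  -- Rotations and unit translations of the hexagonal tiling.

  φ φ⁻ ψ s : A → A
  φ x = σ (α x)
  φ⁻ x = α (σ (σ x))
  ψ x = φ (φ (φ x))
  s x = ψ (α x)

  -- Conjugating `s` by `φ` turns its direction by π/3: index `3 + j` is the inverse of index `j`,
  -- and only the index modulo 6 matters.
  translate : ℕ → A → A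
  translate zero x = s x
  translate (suc j) x = φ⁻ (translate j (φ x))

  φφ⁻ : ∀ x → φ (φ⁻ x) ≡ x
  φφ⁻ x = trans (cong σ (α² _)) (σ³ x)

  φ⁻φ : ∀ x → φ⁻ (φ x) ≡ x
  φ⁻φ x = trans (cong α (σ³ _)) (α² x)

  φ-injective : Injective _≡_ _≡_ φ
  φ-injective {x} {y} eq = trans (sym (φ⁻φ x)) (trans (cong φ⁻ eq) (φ⁻φ y))

  α-injective : Injective _≡_ _≡_ α
  α-injective {x} {y} eq = trans (sym (α² x)) (trans (cong α eq) (α² y))

  ψψ : ∀ x → ψ (ψ x) ≡ x
  ψψ = φ⁶

  ψ-injective : Injective _≡_ _≡_ ψ
  ψ-injective eq = φ-injective (φ-injective (φ-injective eq))

  s-injective : Injective _≡_ _≡_ s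
  s-injective eq = α-injective (ψ-injective eq)

  translate-φ⁻ : ∀ j x → φ⁻ (translate j x) ≡ translate (suc j) (φ⁻ x)
  translate-φ⁻ j x = cong (φ⁻ ∘ translate j) (sym (φφ⁻ x))

  φ-translate : ∀ j x → φ (translate (suc j) x) ≡ translate j (φ x)
  φ-translate j x = φφ⁻ _

  φ⁻³ψ : ∀ x → φ⁻ (φ⁻ (φ⁻ (ψ x))) ≡ x
  φ⁻³ψ x = trans (cong (φ⁻ ∘ φ⁻) (φ⁻φ _)) (trans (cong φ⁻ (φ⁻φ _)) (φ⁻φ _))

  translate₃ : ∀ x → translate 3 x ≡ α (ψ x)
  translate₃ x = φ⁻³ψ _

  translate-inverseˡ : ∀ j x → translate (3 + j) (translate j x) ≡ x
  translate-inverseˡ zero x = trans (translate₃ (s x)) (trans (cong α (ψψ _)) (α² x))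
  translate-inverseˡ (suc j) x = trans (cong (φ⁻ ∘ translate (3 + j)) (φφ⁻ _))
    (trans (cong φ⁻ (translate-inverseˡ j (φ x))) (φ⁻φ x))

  translate-inverseʳ : ∀ j x → translate j (translate (3 + j) x) ≡ x
  translate-inverseʳ zero x = trans (cong s (translate₃ x)) (trans (cong ψ (α² _)) (ψψ x))
  translate-inverseʳ (suc j) x = trans (cong (φ⁻ ∘ translate j) (φφ⁻ _))
    (trans (cong φ⁻ (translate-inverseʳ j (φ x))) (φ⁻φ x))

  ψ-translate : ∀ j x → ψ (translate j x) ≡ translate (3 + j) (ψ x)
  ψ-translate j x = begin
    ψ (translate j x)                          ≡⟨ φ⁻³ψ _ ⟨
    φ⁻ (φ⁻ (φ⁻ (ψ (ψ (translate j x)))))       ≡⟨ cong (φ⁻ ∘ φ⁻ ∘ φ⁻) (ψψ _) ⟩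
    φ⁻ (φ⁻ (φ⁻ (translate j x)))               ≡⟨ cong (φ⁻ ∘ φ⁻ ∘ φ⁻ ∘ translate j) (ψψ x) ⟨
    φ⁻ (φ⁻ (φ⁻ (translate j (ψ (ψ x)))))       ∎

  translate₁ : ∀ x → translate 1 x ≡ φ (φ (α (φ x)))
  translate₁ x = φ⁻φ _

  translate₂ : ∀ x → translate 2 x ≡ φ (α (φ (φ x)))
  translate₂ x = trans (cong φ⁻ (φ⁻φ _)) (φ⁻φ _)

  -- This is u₀ + u₂ = u₁. Once the pairs of `α` cancel, what remains is the vertex relation `σ³`.
  s-translate₂ : ∀ x → s (translate 2 x) ≡ translate 1 x
  s-translate₂ x = begin
    s (translate 2 x)              ≡⟨ cong s (translate₂ x) ⟩
    φ (φ (φ (α (φ (α (φ (φ x)))))))  ≡⟨⟩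
    φ (φ (σ (α (α (σ (α (α (σ (α (φ x))))))))))
      ≡⟨ cong (φ ∘ φ ∘ σ) (trans (α² _) (cong σ (α² _))) ⟩
    φ (φ (σ (σ (σ (α (φ x))))))    ≡⟨ cong (φ ∘ φ) (σ³ _) ⟩
    φ (φ (α (φ x)))                ≡⟨ translate₁ x ⟨
    translate 1 x                  ∎

  translate₂-s : ∀ x → translate 2 (s x) ≡ translate 1 x
  translate₂-s x = begin
    translate 2 (s x)              ≡⟨ translate₂ (s x) ⟩
    φ (α (φ (φ (φ (φ (φ (α x)))))))  ≡⟨ cong (φ ∘ α) φ⁵ ⟩
    φ (α (φ⁻ (α x)))               ≡⟨ cong φ (α² _) ⟩
    φ (σ (σ (α x)))                ≡⟨ cong (φ ∘ σ) (α² _) ⟨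
    φ (φ (α (φ x)))                ≡⟨ translate₁ x ⟨
    translate 1 x                  ∎
    where
    φ⁵ : φ (φ (φ (φ (φ (α x))))) ≡ φ⁻ (α x)
    φ⁵ = trans (sym (φ⁻φ _)) (cong φ⁻ (φ⁶ (α x)))

  translate₁-s : ∀ x → translate 1 (s x) ≡ s (translate 1 x)
  translate₁-s x = trans (sym (s-translate₂ (s x))) (cong s (translate₂-s x))

  translate₂-s^ : ∀ k x → translate 2 (iterate s x k) ≡ iterate s (translate 2 x) k
  translate₂-s^ = iterate-natural (λ x → trans (translate₂-s x) (sym (s-translate₂ x)))

  translate₃-s^ : ∀ k x → translate 3 (iterate s x k) ≡ iterate s (translate 3 x) k
  translate₃-s^ = iterate-natural (λ x → trans (translate-inverseˡ 0 x) (sym (translate-inverseʳ 0 x)))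

  -- A rotation by π/3 composed with a translation is a rotation by π/3 about
  -- another face centre: replacing y by translate 1 y lowers k.
  φ⁻≢s^ : ∀ k y → φ⁻ y ≢ iterate s y k
  φ⁻≢s^ zero y eq = φ-free y (trans (cong φ (sym eq)) (φφ⁻ y))
  φ⁻≢s^ (suc k) y eq = φ⁻≢s^ k (translate 1 y) (begin
    φ⁻ (translate 1 y)               ≡⟨ translate-φ⁻ 1 y ⟩
    translate 2 (φ⁻ y)               ≡⟨ cong (translate 2) eq ⟩
    translate 2 (iterate s (s y) k)  ≡⟨ translate₂-s^ k (s y) ⟩
    iterate s (translate 2 (s y)) k  ≡⟨ cong (λ z → iterate s z k) (translate₂-s y) ⟩
    iterate s (translate 1 y) k      ∎)

  -- Moving `φ⁻` past a translation raises its index by one, so two copies of `φ⁻` turn directions 0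
  -- and 1 into 2 and 3.
  φ⁻²-st₁ : ∀ y → φ⁻ (φ⁻ (s (translate 1 y))) ≡ translate 2 (translate 3 (φ⁻ (φ⁻ y)))
  φ⁻²-st₁ y = begin
    φ⁻ (φ⁻ (s (translate 1 y)))           ≡⟨ cong φ⁻ (translate-φ⁻ 0 _) ⟩
    φ⁻ (translate 1 (φ⁻ (translate 1 y))) ≡⟨ translate-φ⁻ 1 _ ⟩
    translate 2 (φ⁻ (φ⁻ (translate 1 y))) ≡⟨ cong (translate 2 ∘ φ⁻) (translate-φ⁻ 1 y) ⟩
    translate 2 (φ⁻ (translate 2 (φ⁻ y))) ≡⟨ cong (translate 2) (translate-φ⁻ 2 _) ⟩
    translate 2 (translate 3 (φ⁻ (φ⁻ y))) ∎

  -- Rotations by 2π/3 are centred at faces or at vertices, according to k mod 3.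
  φ⁻²≢s^ : ∀ k y → φ⁻ (φ⁻ y) ≢ iterate s y k
  φ⁻²≢s^ 0 y eq = φ²-free y (trans (cong (φ ∘ φ) (sym eq)) (trans (cong φ (φφ⁻ _)) (φφ⁻ y)))
  -- Here both `φ y` and `α y` are sent to `y` by the fifth power of `φ`. They are thus equal, and
  -- `σ` fixes `α y`.
  φ⁻²≢s^ 1 y eq = σ-free (α y) (ψ-injective (φ-injective (φ-injective (begin
    φ (φ (ψ (φ y)))    ≡⟨ φ⁶ y ⟩
    y                  ≡⟨ φφ⁻ y ⟨
    φ (φ⁻ y)           ≡⟨ cong φ (φφ⁻ _) ⟨
    φ (φ (φ⁻ (φ⁻ y)))  ≡⟨ cong (φ ∘ φ) eq ⟩
    φ (φ (ψ (α y)))    ∎))))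
  -- The equation gives `s z ≡ φ (φ z)`; cancelling two factors `φ` leaves `φ (α z) ≡ z`, which says
  -- that `σ` fixes `z`.
  φ⁻²≢s^ 2 y eq = σ-free z (trans (cong σ (sym (α² z))) (φ-injective (φ-injective (begin
    s z            ≡⟨ cong s φ⁻²x≡ty ⟩
    s (translate 1 y)  ≡⟨⟩
    x              ≡⟨ φφ⁻ x ⟨
    φ (φ⁻ x)       ≡⟨ cong φ (φφ⁻ _) ⟨
    φ (φ z)        ∎))))
    where
    x z : A
    x = s (translate 1 y)
    z = φ⁻ (φ⁻ x)
    φ⁻²x≡ty : z ≡ translate 1 y
    φ⁻²x≡ty = begin
      φ⁻ (φ⁻ x)                             ≡⟨ φ⁻²-st₁ y ⟩
      translate 2 (translate 3 (φ⁻ (φ⁻ y))) ≡⟨ cong (translate 2 ∘ translate 3) eq ⟩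
      translate 2 (translate 3 (s (s y)))  ≡⟨ cong (translate 2) (translate-inverseˡ 0 (s y)) ⟩
      translate 2 (s y)                    ≡⟨ translate₂-s y ⟩
      translate 1 y                        ∎
  φ⁻²≢s^ (suc (suc (suc k))) y eq = φ⁻²≢s^ k (s (translate 1 y)) (begin
    φ⁻ (φ⁻ (s (translate 1 y)))           ≡⟨ φ⁻²-st₁ y ⟩
    translate 2 (translate 3 (φ⁻ (φ⁻ y))) ≡⟨ cong (translate 2 ∘ translate 3) eq ⟩
    translate 2 (translate 3 (iterate s (s (s (s y))) k)) ≡⟨ cong (translate 2) (translate₃-s^ k _) ⟩
    translate 2 (iterate s (translate 3 (s (s (s y)))) k) ≡⟨ translate₂-s^ k _ ⟩
    iterate s (translate 2 (translate 3 (s (s (s y))))) k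
      ≡⟨ cong (λ z → iterate s (translate 2 z) k) (translate-inverseˡ 0 _) ⟩
    iterate s (translate 2 (s (s y))) k  ≡⟨ cong (λ z → iterate s z k) (translate₂-s (s y)) ⟩
    iterate s (translate 1 (s y)) k      ≡⟨ cong (λ z → iterate s z k) (translate₁-s y) ⟩
    iterate s (s (translate 1 y)) k      ∎)

  -- A half-turn about an edge would give a fixed point of α, so k is even and
  -- the half-turn is about the face halfway between y and ψ y.
  midpoint : ∀ k y → iterate s y k ≡ ψ y → ∃ λ l → l + l ≡ k × ψ (iterate s y l) ≡ iterate s y l
  midpoint 0 y eq = 0 , refl , sym eq
  midpoint 1 y eq = contradiction (ψ-injective eq) (α-free y)
  midpoint (suc (suc k)) y eq with midpoint k (s y) (begin
      iterate s (s y) k                  ≡⟨ translate-inverseˡ 0 _ ⟨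
      translate 3 (s (iterate s (s y) k)) ≡⟨ cong (translate 3) (iterate-suc s (s y) k) ⟨
      translate 3 (iterate s (s y) (suc k)) ≡⟨ cong (translate 3) eq ⟩
      translate 3 (ψ y)                  ≡⟨ ψ-translate 0 y ⟨
      ψ (s y)                            ∎)
  ... | l , refl , fixed = suc l , cong suc (+-suc l l) , fixed

  -- Fixed points of the half-turn along lines of translates.

  Fixed : A → Set
  Fixed d = ψ d ≡ d

  fixed-φ : ∀ {d} → Fixed d → Fixed (φ d)
  fixed-φ = cong φ

  s^-fixed : ∀ {d} → Fixed d → ∀ k → ψ (iterate s d k) ≡ iterate (translate 3) d k
  s^-fixed {d} fd k = trans (iterate-natural (ψ-translate 0) k d) (cong (λ z → iterate (translate 3) z k) fd)

  -- Since `ψ` reverses `s`, a fixed dart `n` steps ahead of the fixed dart `d` is also `n` steps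
  -- behind it.
  fixed⇒period : ∀ {d} n → Fixed d → Fixed (iterate s d n) → iterate s d (n + n) ≡ d
  fixed⇒period {d} n fd fy = begin
    iterate s d (n + n)            ≡⟨ iterate-+ s d n n ⟩
    iterate s (iterate s d n) n    ≡⟨ cong (λ z → iterate s z n) (trans (sym fy) (s^-fixed fd n)) ⟩
    iterate s (iterate (translate 3) d n) n ≡⟨ iterate-inverse (translate-inverseʳ 0) n d ⟩
    d                              ∎

  period⇒fixed : ∀ {d} n → Fixed d → iterate s d (n + n) ≡ d → Fixed (iterate s d n)
  period⇒fixed {d} n fd eq with midpoint (n + n) d (trans eq (sym fd))
  -- Halving `l + l ≡ n + n` identifies the midpoint with the `n`-th translate.
  ... | l , l+l≡n+n , fixed = subst (λ k → Fixed (iterate s d k))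
    (trans (n≡⌊n+n/2⌋ l) (trans (cong ⌊_/2⌋ l+l≡n+n) (sym (n≡⌊n+n/2⌋ n)))) fixed

  FirstFixed : A → ℕ → Set
  FirstFixed d = IsLeast (λ n → Fixed (iterate s d (suc n)))

  -- Otherwise `midpoint` would give a fixed dart halfway along, before the first one.
  firstFixed⇒≢ : ∀ {d n} → FirstFixed d n → iterate s d (suc n) ≢ ψ d
  firstFixed⇒≢ {d} {n} (_ , below) eq with midpoint (suc n) d eq
  ... | suc l , l+l≡n , fixed = below (subst (suc l ≤_) (suc-injective l+l≡n) (m≤n+m (suc l) l)) fixed

  φ²-translate₂^ : ∀ k x → φ (φ (iterate (translate 2) x k)) ≡ iterate s (φ (φ x)) k
  φ²-translate₂^ = iterate-natural (λ x → trans (cong φ (φ-translate 1 x)) (φ-translate 0 (φ x)))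

  -- If the line of translates in direction 0 through translate 2 d meets a
  -- triangle, then translating d twice in direction 2 is the same as translating
  -- it an even number of times in direction 0.
  module _ {d} (fd : Fixed d) {k} (hit : Fixed (iterate s (translate 2 d) k)) where

    t₂² : A → A
    t₂² x = translate 2 (translate 2 x)

    t₂²-s^ : ∀ j x → t₂² (iterate s x j) ≡ iterate s (t₂² x) j
    t₂²-s^ j x = trans (cong (translate 2) (translate₂-s^ j x)) (translate₂-s^ j (translate 2 x))

    s^-t₂²^ : ∀ j m x → iterate s (iterate t₂² x m) j ≡ iterate t₂² (iterate s x j) m
    s^-t₂²^ j = iterate-natural {h = λ x → iterate s x j} (λ x → sym (t₂²-s^ j x))

    -- The half-turns fixing `d` and the dart of the hit compose to the translation by twice the
    -- vector k u₀ + u₂ between them.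
    relation : iterate s (t₂² d) (k + k) ≡ d
    relation = begin
      iterate s (t₂² d) (k + k)               ≡⟨ iterate-+ s (t₂² d) k k ⟩
      iterate s (iterate s (t₂² d) k) k
        ≡⟨ cong (λ z → iterate s z k) (translate₂-s^ k (translate 2 d)) ⟨
      iterate s (translate 2 (iterate s (translate 2 d) k)) k ≡⟨ translate₂-s^ k _ ⟨
      translate 2 (iterate s (iterate s (translate 2 d) k) k)
        ≡⟨ cong (λ z → translate 2 (iterate s z k)) reflected ⟩
      translate 2 (iterate s (iterate (translate 3) (translate 5 d) k) k)
        ≡⟨ cong (translate 2) (iterate-inverse (translate-inverseʳ 0) k (translate 5 d)) ⟩
      translate 2 (translate 5 d)             ≡⟨ translate-inverseʳ 2 d ⟩
      d                                       ∎
      where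
      reflected : iterate s (translate 2 d) k ≡ iterate (translate 3) (translate 5 d) k
      reflected = begin
        iterate s (translate 2 d) k                ≡⟨ hit ⟨
        ψ (iterate s (translate 2 d) k)            ≡⟨ iterate-natural (ψ-translate 0) k _ ⟩
        iterate (translate 3) (ψ (translate 2 d)) k
          ≡⟨ cong (λ z → iterate (translate 3) z k) (ψ-translate 2 d) ⟩
        iterate (translate 3) (translate 5 (ψ d)) k
          ≡⟨ cong (λ z → iterate (translate 3) (translate 5 z) k) fd ⟩
        iterate (translate 3) (translate 5 d) k    ∎

    relation^ : ∀ m → iterate s (iterate t₂² d m) (m * (k + k)) ≡ d
    relation^ zero = refl
    relation^ (suc m) = begin
      iterate s (iterate t₂² (t₂² d) m) (k + k + m * (k + k)) ≡⟨ iterate-+ s _ (k + k) (m * (k + k)) ⟩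
      iterate s (iterate s (iterate t₂² (t₂² d) m) (k + k)) (m * (k + k))
        ≡⟨ cong (λ z → iterate s z (m * (k + k))) (s^-t₂²^ (k + k) m (t₂² d)) ⟩
      iterate s (iterate t₂² (iterate s (t₂² d) (k + k)) m) (m * (k + k))
        ≡⟨ cong (λ z → iterate s (iterate t₂² z m) (m * (k + k))) relation ⟩
      iterate s (iterate t₂² d m) (m * (k + k))        ≡⟨ relation^ m ⟩
      d                                                ∎

    -- Write translations additively. By `relation^`, 2n u₂ + 2nk u₀ fixes `d`; so does 2n u₀ by
    -- `fixed⇒period`, hence 2n u₂ does as well. Rotating by `φ` twice makes this a period of `s` at
    -- `φ (φ d)`, and half of that period leads to a fixed dart.
    fixed-turn : ∀ n → Fixed (iterate s d n) → Fixed (iterate s (φ (φ d)) n)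
    fixed-turn n fy = period⇒fixed n (fixed-φ (fixed-φ fd)) (begin
      iterate s (φ (φ d)) (n + n)           ≡⟨ φ²-translate₂^ (n + n) d ⟨
      φ (φ (iterate (translate 2) d (n + n)))
        ≡⟨ cong (φ ∘ φ) (trans (iterate-double (translate 2) d n) t₂²^n≡d) ⟩
      φ (φ d)                               ∎)
      where
      period-s : iterate s d (n * (k + k)) ≡ d
      period-s = trans (cong (iterate s d) 
        (trans (*-distribˡ-+ n k k) (trans (cong₂ _+_ (*-comm n k) (*-comm n k)) (sym (*-distribˡ-+ k n n)))))
                       (iterate-* (fixed⇒period n fd fy) k)
      t₂²^n≡d : iterate t₂² d n ≡ d
      t₂²^n≡d = begin
        iterate t₂² d n                               ≡⟨ cong (λ z → iterate t₂² z n) period-s ⟨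
        iterate t₂² (iterate s d (n * (k + k))) n     ≡⟨ s^-t₂²^ (n * (k + k)) n d ⟨
        iterate s (iterate t₂² d n) (n * (k + k))     ≡⟨ relation^ n ⟩
        d                                             ∎

  module _ (hits : ∀ x → ∃ λ k → Fixed (iterate s x k)) where

    firstFixed-φ² : ∀ {d n} → Fixed d → FirstFixed d n → FirstFixed (φ (φ d)) n
    -- An earlier fixed dart on the turned line would, after two more double turns, be an earlier
    -- one on the line of `d`, because `φ⁶` is the identity.
    firstFixed-φ² {d} {n} fd (fy , below) = turn d fd (suc n) fy , λ {j} j<n fz →
      below j<n (subst (λ x → Fixed (iterate s x (suc j))) (φ⁶ d)
        (turn _ (fixed-φ (fixed-φ (fixed-φ (fixed-φ fd)))) (suc j) (turn _ (fixed-φ (fixed-φ fd)) (suc j) fz)))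
      where
      turn : ∀ d → Fixed d → ∀ n → Fixed (iterate s d n) → Fixed (iterate s (φ (φ d)) n)
      turn d fd = fixed-turn fd {proj₁ (hits (translate 2 d))} (proj₂ (hits (translate 2 d)))

    firstFixed-φ : ∀ {d n} → Fixed d → FirstFixed d n → FirstFixed (φ d) n
    -- For fixed `d` three applications of `φ` do nothing, so `φ d` is reached by two double turns.
    firstFixed-φ {d} {n} fd ff = subst (λ x → FirstFixed x n) (cong φ fd)
      (firstFixed-φ² (fixed-φ (fixed-φ fd)) (firstFixed-φ² fd ff))

  -- Faces met along a line of translates.

  module _ (returns : ∀ k y → ∃ λ l → iterate s (iterate s y k) l ≡ y) where

    -- Reduce `m` modulo 6. Residues 5 and 4 are ruled out by `φ⁻≢s^` and `φ⁻²≢s^` at `y`. Residues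
    -- 1 and 2 are ruled out by the same lemmas at `iterate s y k`, from which `returns` leads back
    -- to `y` by powers of `s`.
    rotated-translate : ∀ m {k y} → iterate φ y m ≡ iterate s y k →
                        iterate s y k ≡ y ⊎ iterate s y k ≡ ψ y
    rotated-translate 0 eq = inj₁ (sym eq)
    rotated-translate 1 {k} {y} eq with returns k y
    ... | l , back = contradiction
      (trans (cong φ⁻ (sym eq)) (trans (φ⁻φ y) (sym back))) (φ⁻≢s^ l _)
    rotated-translate 2 {k} {y} eq with returns k y
    ... | l , back = contradiction
      (trans (cong (φ⁻ ∘ φ⁻) (sym eq)) (trans (cong φ⁻ (φ⁻φ _)) (trans (φ⁻φ y) (sym back)))) (φ⁻²≢s^ l _)
    rotated-translate 3 eq = inj₂ (sym eq)
    rotated-translate 4 {k} {y} eq = contradiction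
      (trans (cong (φ⁻ ∘ φ⁻) (sym (φ⁶ y))) (trans (cong φ⁻ (φ⁻φ _)) (trans (φ⁻φ _) eq))) (φ⁻²≢s^ k y)
    rotated-translate 5 {k} {y} eq = contradiction (trans (cong φ⁻ (sym (φ⁶ y))) (trans (φ⁻φ _) eq)) (φ⁻≢s^ k y)
    rotated-translate (suc (suc (suc (suc (suc (suc m)))))) {k} {y} eq =
      rotated-translate m {k} (trans (cong (λ z → iterate φ z m) (sym (φ⁶ y))) eq)

    -- Two darts of the line in one face would be equal, against the period, or related by `ψ`, and
    -- then `midpoint` gives a fixed dart on the line.
    line-distinct : ∀ {x p} → (∀ k → ¬ Fixed (iterate s x k)) → HasPeriod s x p →
                    ∀ {i j} → i < j → j < suc p → ∀ m → iterate φ (iterate s x i) m ≢ iterate s x j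
    line-distinct {x} unfixed per {i} i<j j<p m eq with m≤n⇒∃[o]m+o≡n i<j
    ... | o , refl = case (rotated-translate m {suc o} (trans eq split))
      where
      split : iterate s x (suc i + o) ≡ iterate s (iterate s x i) (suc o)
      split = trans (cong (iterate s x) (sym (+-suc i o))) (iterate-+ s x i (suc o))
      case : iterate s (iterate s x i) (suc o) ≡ iterate s x i ⊎
             iterate s (iterate s x i) (suc o) ≡ ψ (iterate s x i) → ⊥
      case (inj₁ e) = iterate-distinct s-injective per i<j j<p (sym (trans split e))
      case (inj₂ e) with midpoint (suc o) _ e
      ... | l , _ , fixed = unfixed (i + l) (subst Fixed (sym (iterate-+ s x i l)) fixed)

    firstFixed-leaves-face : ∀ {d n} → Fixed d → FirstFixed d n → ∀ m → iterate φ d m ≢ iterate s d (suc n)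
    firstFixed-leaves-face {n = n} fd ff m eq with rotated-translate m {suc n} eq
    ... | inj₁ e = firstFixed⇒≢ ff (trans e (sym fd))
    ... | inj₂ e = firstFixed⇒≢ ff e

    -- As N u₀ is a half-period at `d`, the two ends differ by N u₂ - N u₀ = N u₁. If they lay in
    -- one face, `rotated-translate` would make N u₁ a period, so the road leaving through `φ d`
    -- would end where it began, against `firstFixed⇒≢`.
    targets-distinct : ∀ {d n} → Fixed d → Fixed (iterate s d (suc n)) → FirstFixed (φ d) n →
                       ∀ m → iterate φ (iterate s d (suc n)) m ≢ iterate (translate 2) d (suc n)
    targets-distinct {d} {n} fd fy ff m eq = firstFixed⇒≢ ff (begin
      iterate s (φ d) N  ≡⟨ φ-translate₁^ d ⟨
      φ (t₁^N d)         ≡⟨ cong φ t₁^N-d ⟩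
      φ d                ≡⟨ fixed-φ fd ⟨
      ψ (φ d)            ∎)
      where
      N = suc n
      t₁^N : A → A
      t₁^N x = iterate (translate 1) x N
      y : A
      y = iterate s d N

      φ-translate₁^ : ∀ x → φ (t₁^N x) ≡ iterate s (φ x) N
      φ-translate₁^ = iterate-natural (φ-translate 0) N

      s^y : iterate s y N ≡ d
      s^y = trans (sym (iterate-+ s d N N)) (fixed⇒period N fd fy)

      t₂^d : iterate (translate 2) d N ≡ t₁^N y
      t₂^d = begin
        iterate (translate 2) d N                ≡⟨ cong (λ z → iterate (translate 2) z N) s^y ⟨
        iterate (translate 2) (iterate s y N) N  ≡⟨ commuting-iterate s-translate₂ translate₂-s N y ⟩
        t₁^N y                                   ∎

      conjugated : iterate φ (φ y) m ≡ iterate s (φ y) N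
      conjugated = begin
        iterate φ (φ y) m  ≡⟨ iterate-suc φ y m ⟩
        φ (iterate φ y m)  ≡⟨ cong φ (trans eq t₂^d) ⟩
        φ (t₁^N y)         ≡⟨ φ-translate₁^ y ⟩
        iterate s (φ y) N  ∎

      fixes-φy : iterate s (φ y) N ≡ φ y
      fixes-φy with rotated-translate m {N} conjugated
      ... | inj₁ e = e
      ... | inj₂ e = trans e (fixed-φ fy)

      t₁^N-y : t₁^N y ≡ y
      t₁^N-y = φ-injective (trans (φ-translate₁^ y) fixes-φy)

      t₁^N-d : t₁^N d ≡ d
      t₁^N-d = begin
        t₁^N d                ≡⟨ cong t₁^N s^y ⟨
        t₁^N (iterate s y N)
          ≡⟨ iterate-natural {h = t₁^N} (λ x → sym (iterate-natural {h = s} (λ x → sym (translate₁-s x)) N x)) N y ⟩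
        iterate s (t₁^N y) N  ≡⟨ cong (λ z → iterate s z N) t₁^N-y ⟩
        iterate s y N         ≡⟨ s^y ⟩
        d                     ∎

-- Counting in finite sets.

lookup-injective : ∀ {A : Set} {xs : List A} → Unique xs → ∀ {i j} → lookup xs i ≡ lookup xs j → i ≡ j
lookup-injective (_ ∷ _) {zero} {zero} _ = refl
lookup-injective (x∉ ∷ _) {zero} {suc j} eq = contradiction eq (All.lookup x∉ (∈-lookup j))
lookup-injective (x∉ ∷ _) {suc i} {zero} eq = contradiction (sym eq) (All.lookup x∉ (∈-lookup i))
lookup-injective (_ ∷ u) {suc i} {suc j} eq = cong suc (lookup-injective u eq)

unique⊆⇒length≤ : ∀ {A : Set} {xs ys : List A} → Unique xs → (∀ {x} → x ∈ xs → x ∈ ys) →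
                  length xs ≤ length ys
unique⊆⇒length≤ {A} {xs} u xs⊆ys = injective⇒≤ {f = λ i → index (xs⊆ys (∈-lookup {xs = xs} i))}
  λ {i} {j} eq → lookup-injective u
    (index-injective (setoid A) (xs⊆ys (∈-lookup i)) (xs⊆ys (∈-lookup j)) eq)

Σ↔Fin : ∀ {m} {P : Fin m → Set} (P? : Decidable P) → Irrelevant P →
        Σ (Fin m) P ↔ Fin (length (filter P? (allFin m)))
Σ↔Fin {m} {P} P? irr = mk↔ₛ′ to from to∘from from∘to
  where
  xs = filter P? (allFin m)
  ∈xs : ∀ {x} → P x → x ∈ xs
  ∈xs = ∈-filter⁺ P? (∈-allFin _)
  to : Σ (Fin m) P → Fin (length xs)
  to (x , px) = index (∈xs px)
  from : Fin (length xs) → Σ (Fin m) P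
  from i = lookup xs i , proj₂ (∈-filter⁻ P? {xs = allFin m} (∈-lookup i))
  ≡-Σ : ∀ {x y} {px : P x} {py : P y} → x ≡ y → (x , px) ≡ (y , py)
  ≡-Σ refl = cong (_ ,_) (irr _ _)
  to∘from : ∀ i → to (from i) ≡ i
  to∘from i = lookup-injective (filter⁺ P? (allFin⁺ m)) (sym (lookup-index (∈xs _)))
  from∘to : ∀ x → from (to x) ≡ x
  from∘to (x , px) = ≡-Σ (sym (lookup-index (∈xs px)))

indicator : ∀ {P : Set} → Dec P → ℕ
indicator P? = if does P? then 1 else 0

length-filter-tabulate : ∀ {A : Set} {P : A → Set} (P? : Decidable P) {n} (f : Fin n → A) →
                         length (filter P? (tabulate f)) ≡ sum (λ i → indicator (P? (f i)))
length-filter-tabulate P? {zero} f = refl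
length-filter-tabulate P? {suc n} f with P? (f zero)
... | yes _ = cong suc (length-filter-tabulate P? (f ∘ suc))
... | no _ = length-filter-tabulate P? (f ∘ suc)

sum-const : ∀ n c → sum {n} (λ _ → c) ≡ n * c
sum-const zero c = refl
sum-const (suc n) c = cong (c +_) (sum-const n c)

sum-indicator : ∀ {n} (i : Fin n) → sum (λ j → indicator (i Fin.≟ j)) ≡ 1
sum-indicator {suc n} zero = cong suc (sum-replicate-zero n)
sum-indicator {suc n} (suc i) = sum-indicator i

-- Double counting: each point of the domain lies in exactly one fibre.
sum-fibreSize : ∀ {n m} (π : Fin n → Fin m) → sum (fibreSize π) ≡ n
sum-fibreSize {n} {m} π = begin
  sum (fibreSize π)
    ≡⟨ sum-cong-≗ (λ y → length-filter-tabulate (λ x → π x Fin.≟ y) id) ⟩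
  sum (λ y → sum (λ x → indicator (π x Fin.≟ y)))       ≡⟨ ∑-comm (λ y x → indicator (π x Fin.≟ y)) ⟩
  sum (λ x → sum (λ y → indicator (π x Fin.≟ y)))       ≡⟨ sum-cong-≗ (λ x → sum-indicator (π x)) ⟩
  sum {n} (λ _ → 1)                                     ≡⟨ sum-const n 1 ⟩
  n * 1                                                 ≡⟨ *-identityʳ n ⟩
  n                                                     ∎

constant-fibreSize : ∀ {n m c} (π : Fin n → Fin m) → (∀ y → fibreSize π y ≡ c) → n ≡ m * c
constant-fibreSize {m = m} {c} π const = trans (sym (sum-fibreSize π)) (trans (sum-cong-≗ const) (sum-const m c))

-- Take six times Euler's formula. With 6v = 2d, 6f = d + 3t and 6e = 3d it reads 3d + 3t = 3d + 12.
euler⇒4 : ∀ {d v e f t} → d ≡ v * 3 → d ≡ e * 2 → d + 3 * t ≡ f * 6 → v + f ≡ e + 2 → t ≡ 4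
euler⇒4 {d} {v} {e} {f} {t} d≡3v d≡2e d+3t≡6f euler = *-cancelˡ-≡ t 4 3 (+-cancelˡ-≡ (d + d + d) _ _ (begin
  d + d + d + 3 * t          ≡⟨ +-assoc (d + d) d (3 * t) ⟩
  d + d + (d + 3 * t)        ≡⟨ cong₂ (λ x y → x + x + y) d≡3v d+3t≡6f ⟩
  v * 3 + v * 3 + f * 6      ≡⟨ cong (_+ f * 6) (*-distribˡ-+ v 3 3) ⟨
  v * 6 + f * 6              ≡⟨ *-distribʳ-+ 6 v f ⟨
  (v + f) * 6                ≡⟨ cong (_* 6) euler ⟩
  (e + 2) * 6                ≡⟨ *-distribʳ-+ 6 e 2 ⟩
  e * 6 + 12
    ≡⟨ cong (_+ 12) (trans (*-distribˡ-+ e 4 2) (cong (_+ e * 2) (*-distribˡ-+ e 2 2))) ⟩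
  e * 2 + e * 2 + e * 2 + 12 ≡⟨ cong (λ x → x + x + x + 12) d≡2e ⟨
  d + d + d + 12             ∎))

-- The darts of a trihex under the hexagonal action.

module TrihexProperties (T : Trihex) where

  open Trihex T

  module _ {f : Dart → Dart} {m} {π : Dart → Fin m} (isOrbitMap : IsOrbitMap f π) (inj : Injective _≡_ _≡_ f) where

    fibreSize⇒period : ∀ {d p} → fibreSize π (π d) ≡ suc p → HasPeriod f d p
    fibreSize⇒period {d} {p} size with period inj d
    ... | q , per = subst (HasPeriod f d) (suc-injective (trans (sym (fibreSize-period isOrbitMap inj per)) size)) per

  σ-injective : Injective _≡_ _≡_ σ
  σ-injective eq = trans (sym (inverseˡ rotation)) (trans (cong (rotation ⟨$⟩ˡ_) eq) (inverseˡ rotation))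

  α-inj : Injective _≡_ _≡_ α
  α-inj {x} {y} eq = trans (sym (α-involutive x)) (trans (cong α eq) (α-involutive y))

  φ-inj : Injective _≡_ _≡_ φ
  φ-inj eq = α-inj (σ-injective eq)

  σ-period : ∀ d → HasPeriod σ d 2
  σ-period d = fibreSize⇒period tail-orbits σ-injective (cubic (tail d))

  α-period : ∀ d → HasPeriod α d 1
  α-period d = α-involutive d , λ { {zero} _ → α-no-fixed d ; {suc _} (s≤s ()) }

  triangle-period : ∀ {d} → IsTriangle (face d) → HasPeriod φ d 2
  triangle-period = fibreSize⇒period face-orbits φ-inj

  hexagon-period : ∀ {d} → IsHexagon (face d) → HasPeriod φ d 5
  hexagon-period = fibreSize⇒period face-orbits φ-inj

  φ⁶ : ∀ d → iterate φ d 6 ≡ d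
  φ⁶ d with triangle-or-hexagon (face d)
  ... | inj₁ tri = iterate-* {f = φ} {p = 3} (proj₁ (triangle-period tri)) 2
  ... | inj₂ hex = proj₁ (hexagon-period hex)

  φ^-free : ∀ {j} → j < 2 → ∀ d → iterate φ d (suc j) ≢ d
  φ^-free j<2 d with triangle-or-hexagon (face d)
  ... | inj₁ tri = proj₂ (triangle-period tri) j<2
  ... | inj₂ hex = proj₂ (hexagon-period hex) (≤-trans j<2 (s≤s (s≤s z≤n)))

  open Hexagonal α σ α-involutive (λ d → proj₁ (σ-period d)) φ⁶ α-no-fixed
    (λ d → proj₂ (σ-period d) (s≤s z≤n)) (φ^-free (s≤s z≤n)) (φ^-free (s≤s (s≤s z≤n)))
    hiding (φ; α-injective; φ-injective)

  triangle⇒fixed : ∀ {d} → IsTriangle (face d) → Fixed d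
  triangle⇒fixed tri = proj₁ (triangle-period tri)

  fixed⇒triangle : ∀ {d} → Fixed d → IsTriangle (face d)
  fixed⇒triangle {d} fd with triangle-or-hexagon (face d)
  ... | inj₁ tri = tri
  ... | inj₂ hex = contradiction fd (proj₂ (hexagon-period hex) (s≤s (s≤s (s≤s z≤n))))

  hexagon⇒¬fixed : ∀ {d} → IsHexagon (face d) → ¬ Fixed d
  hexagon⇒¬fixed hex fd with trans (sym hex) (fixed⇒triangle fd)
  ... | ()

  ¬fixed⇒hexagon : ∀ {d} → ¬ Fixed d → IsHexagon (face d)
  ¬fixed⇒hexagon {d} ¬fd = fromInj₂ (λ tri → contradiction (triangle⇒fixed tri) ¬fd) (triangle-or-hexagon (face d))

  face-φ : ∀ d → face (φ d) ≡ face d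
  face-φ d = sym (Equivalence.from (IsOrbitMap.orbits face-orbits d (φ d)) (1 , refl))

  face-s : ∀ d → face (s d) ≡ face (α d)
  face-s d = trans (face-φ _) (trans (face-φ _) (face-φ _))

  face-s^suc : ∀ d k → face (iterate s d (suc k)) ≡ face (α (iterate s d k))
  face-s^suc d k = trans (cong face (iterate-suc s d k)) (face-s _)

  same-face : ∀ {d d′} → face d ≡ face d′ → SameOrbit φ d d′
  same-face {d} {d′} = Equivalence.to (IsOrbitMap.orbits face-orbits d d′)

  returns : ∀ k y → ∃ λ l → iterate s (iterate s y k) l ≡ y
  returns = iterate-returns s-injective

  hexagon⇒straight : ∀ {d} k → IsHexagon (face (iterate s d (suc k))) →
                      Straight T (iterate s d k) (iterate s d (suc k))
  hexagon⇒straight {d} k hex = subst IsHexagon (face-s^suc d k) hex , iterate-suc s d k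

  -- Belts and pseudo-roads as orbits of `s`.

  module _ (x : Dart) (unfixed : ∀ k → ¬ Fixed (iterate s x k)) where

    line-hexagons : ∀ k → IsHexagon (face (iterate s x k))
    line-hexagons k = ¬fixed⇒hexagon (unfixed k)

    line-distinct-faces : ∀ {p} → HasPeriod s x p → ∀ {i j} → i < j → j < suc p →
                          face (iterate s x i) ≢ face (iterate s x j)
    line-distinct-faces per i<j j<p same =
      let m , eq = same-face same in line-distinct returns unfixed per i<j j<p m eq

    line-belt : ∀ {p} → HasPeriod s x p → Belt T
    line-belt {p} per = record
      { n = p
      ; e = λ i → iterate s x (toℕ i)
      ; distinct = distinct
      ; steps = λ i → subst (λ k → Straight T (iterate s x k) (iterate s x (suc (toℕ i)))) (sym (toℕ-inject₁ i))
                        (hexagon⇒straight (toℕ i) (line-hexagons (suc (toℕ i))))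
      ; closes = subst₂ (Straight T) (cong (iterate s x) (sym (toℕ-fromℕ p))) (proj₁ per)
                   (hexagon⇒straight p (line-hexagons (suc p)))
      }
      where
      distinct : Injective _≡_ _≡_ (λ (i : Fin (suc p)) → face (iterate s x (toℕ i)))
      distinct {i} {j} same with <-cmp (toℕ i) (toℕ j)
      ... | tri< i<j _ _ = contradiction same (line-distinct-faces per i<j (toℕ<n j))
      ... | tri≈ _ i≡j _ = toℕ-injective i≡j
      ... | tri> _ _ j<i = contradiction (sym same) (line-distinct-faces per j<i (toℕ<n i))

  tight⇒hits : Tight T → ∀ x → ∃ λ k → Fixed (iterate s x k)
  tight⇒hits tight x = fromInj₁ (λ unfixed → contradiction (line-belt x unfixed (proj₂ (period s-injective x))) tight)
    (orbit-meets? s-injective (λ y → ψ y Fin.≟ y) x)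

  firstFixed : ∀ {d} → Fixed d → ∃ (FirstFixed d)
  firstFixed = first-return s-injective (λ y → ψ y Fin.≟ y)

  -- The first triangle is entered at step `suc n`, so exactly `n` hexagons lie in between.
  firstFixed⇒road : ∀ {d n} → FirstFixed d n → PseudoRoad T (face d) (face (iterate s d (suc n)))
  firstFixed⇒road {d} {n} (_ , below) = record
    { ℓ = n
    ; e = λ i → iterate s d (toℕ i)
    ; starts = refl
    ; ends = trans (cong (λ k → face (α (iterate s d k))) (toℕ-fromℕ n)) (sym (face-s^suc d n))
    ; steps = λ i → subst (λ k → Straight T (iterate s d k) (iterate s d (suc (toℕ i)))) (sym (toℕ-inject₁ i))
                      (hexagon⇒straight (toℕ i) (¬fixed⇒hexagon (below (toℕ<n i))))
    }

  straight-iterate : ∀ {ℓ} (e : Fin (suc ℓ) → Dart) → (∀ i → e (suc i) ≡ s (e (inject₁ i))) →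
                     ∀ i → e i ≡ iterate s (e zero) (toℕ i)
  straight-iterate e steps zero = refl
  straight-iterate {suc ℓ} e steps (suc i) = trans (straight-iterate (e ∘ suc) (steps ∘ suc) i)
    (cong (λ d → iterate s d (toℕ i)) (steps zero))

  module _ {c d} (road : PseudoRoad T c d) where
    open PseudoRoad road

    road-iterate : ∀ i → e i ≡ iterate s (e zero) (toℕ i)
    road-iterate = straight-iterate e (λ i → proj₂ (steps i))

    road-end : face (iterate s (e zero) (suc ℓ)) ≡ d
    road-end = begin
      face (iterate s (e zero) (suc ℓ))  ≡⟨ face-s^suc (e zero) ℓ ⟩
      face (α (iterate s (e zero) ℓ))    ≡⟨ cong (λ k → face (α (iterate s (e zero) k))) (toℕ-fromℕ ℓ) ⟨
      face (α (iterate s (e zero) (toℕ (fromℕ ℓ)))) ≡⟨ cong (face ∘ α) (road-iterate (fromℕ ℓ)) ⟨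
      face (α (e (fromℕ ℓ)))             ≡⟨ ends ⟩
      d                                  ∎

    road-firstFixed : IsTriangle d → FirstFixed (e zero) ℓ
    road-firstFixed td = triangle⇒fixed (subst IsTriangle (sym road-end) td) ,
      λ j<ℓ → below (fromℕ< j<ℓ) (toℕ-fromℕ< j<ℓ)
      where
      below : ∀ (i : Fin ℓ) {j} → toℕ i ≡ j → ¬ Fixed (iterate s (e zero) (suc j))
      below i refl = hexagon⇒¬fixed (subst IsHexagon (begin
        face (α (e (inject₁ i)))            ≡⟨ cong (face ∘ α) (road-iterate (inject₁ i)) ⟩
        face (α (iterate s (e zero) (toℕ (inject₁ i))))
          ≡⟨ cong (λ k → face (α (iterate s (e zero) k))) (toℕ-inject₁ i) ⟩
        face (α (iterate s (e zero) (toℕ i))) ≡⟨ face-s^suc (e zero) (toℕ i) ⟨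
        face (iterate s (e zero) (suc (toℕ i))) ∎) (proj₁ (steps i)))

    -- This excludes loops: a pseudo-road follows `s` to the first fixed dart, which by
    -- `firstFixed-leaves-face` lies in another face.
    road⇒≢ : IsTriangle c → IsTriangle d → c ≢ d
    road⇒≢ tc td c≡d =
      let m , eq = same-face (trans starts (trans c≡d (sym road-end)))
      in firstFixed-leaves-face returns (triangle⇒fixed (subst IsTriangle (sym starts) tc)) (road-firstFixed td) m eq

  -- The four triangles, by Euler's formula.

  triangles : List Face
  triangles = filter (λ f → sides f ℕ.≟ 3) (allFin #faces)

  four-triangles : length triangles ≡ 4
  four-triangles = euler⇒4 {#darts} {#vertices} {#edges} {#faces}
    (constant-fibreSize tail cubic)
    (constant-fibreSize edge edge-size)
    (begin
      #darts + 3 * length triangles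
        ≡⟨ cong₂ (λ x y → x + 3 * y) (sym (sum-fibreSize face)) (length-filter-tabulate tri? id) ⟩
      sum sides + 3 * sum isTri              ≡⟨ cong (sum sides +_) (*-distribˡ-sum 3 isTri) ⟩
      sum sides + sum (λ f → 3 * isTri f)    ≡⟨ ∑-distrib-+ sides (λ f → 3 * isTri f) ⟨
      sum (λ f → sides f + 3 * isTri f)      ≡⟨ sum-cong-≗ weight ⟩
      sum {#faces} (λ _ → 6)                       ≡⟨ sum-const #faces 6 ⟩
      #faces * 6                                   ∎)
    planar
    where
    tri? : Decidable IsTriangle
    tri? f = sides f ℕ.≟ 3
    isTri : Face → ℕ
    isTri f = indicator (tri? f)
    edge-size : ∀ y → fibreSize edge y ≡ 2
    edge-size y with IsOrbitMap.surjective edge-orbits y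
    ... | d , refl = fibreSize-period edge-orbits α-inj (α-period d)
    -- Three extra sides for each triangle make every face count as six.
    weight : ∀ f → sides f + 3 * isTri f ≡ 6
    weight f with triangle-or-hexagon f
    ... | inj₁ tri = cong (λ n → n + 3 * indicator (n ℕ.≟ 3)) tri
    ... | inj₂ hex = cong (λ n → n + 3 * indicator (n ℕ.≟ 3)) hex

  -- Pseudo-roads in a tight trihex.

  module _ (tight : Tight T) where

    hits : ∀ x → ∃ λ k → Fixed (iterate s x k)
    hits = tight⇒hits tight

    -- Up to a rotation within its face, the end of the road from `φ (φ d)` is `d` translated in
    -- direction 2, so `targets-distinct` applies.
    road-ends-distinct : ∀ {d n} → Fixed d → FirstFixed d n →
                         face (iterate s d (suc n)) ≢ face (iterate s (φ (φ d)) (suc n))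
    road-ends-distinct {d} {n} fd ff same =
      let m , eq = same-face (trans same (trans (cong face (sym (φ²-translate₂^ (suc n) d))) (trans (face-φ _) (face-φ _))))
      in targets-distinct returns fd (proj₁ ff) (firstFixed-φ hits fd ff) m eq

    firstFixed⇒roads : ∀ {d₀ n d} → IsTriangle (face d₀) → FirstFixed d₀ n → IsTriangle d →
                       face d₀ ≢ d → PseudoRoad T (face d₀) d
    firstFixed⇒roads {d₀} {n} {d} tc ff₀ td c≢d = find ∈targets
      where
      N = suc n
      c = face d₀
      -- Double turns also run through all three sides of a triangle, and they are the turns that
      -- `firstFixed-φ²` and `road-ends-distinct` handle.
      d₁ = φ (φ d₀)
      d₂ = φ (φ d₁)
      fd₀ : Fixed d₀
      fd₀ = triangle⇒fixed tc
      fd₁ : Fixed d₁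
      fd₁ = fixed-φ (fixed-φ fd₀)
      fd₂ : Fixed d₂
      fd₂ = fixed-φ (fixed-φ fd₁)
      ff₁ : FirstFixed d₁ n
      ff₁ = firstFixed-φ² hits fd₀ ff₀
      ff₂ : FirstFixed d₂ n
      ff₂ = firstFixed-φ² hits fd₁ ff₁
      target : Dart → Face
      target x = face (iterate s x N)

      road : ∀ {x} → face x ≡ c → FirstFixed x n → PseudoRoad T c (target x)
      road {x} same ff = subst (λ f → PseudoRoad T f (target x)) same (firstFixed⇒road ff)
      face₁ : face d₁ ≡ c
      face₁ = trans (face-φ _) (face-φ _)
      road₀ = road refl ff₀
      road₁ = road face₁ ff₁
      road₂ = road (trans (face-φ _) (trans (face-φ _) face₁)) ff₂

      avoids : ∀ {x} → FirstFixed x n → PseudoRoad T c (target x) → c ≢ target x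
      avoids ff r = road⇒≢ r tc (fixed⇒triangle (proj₁ ff))

      ends : List Face
      ends = target d₀ ∷ target d₁ ∷ target d₂ ∷ []

      ends-distinct : Unique (c ∷ ends)
      ends-distinct = (avoids ff₀ road₀ ∷ avoids ff₁ road₁ ∷ avoids ff₂ road₂ ∷ [])
        ∷ (road-ends-distinct fd₀ ff₀
            -- The double turn of `d₂` is `d₀` again by `φ⁶`, which settles the remaining pair of
            -- ends.
            ∷ (λ eq → road-ends-distinct fd₂ ff₂ (trans (sym eq) (cong target (sym (φ⁶ d₀))))) ∷ [])
        ∷ (road-ends-distinct fd₁ ff₁ ∷ []) ∷ [] ∷ []

      ∈triangles : ∀ {f} → IsTriangle f → f ∈ triangles
      ∈triangles = ∈-filter⁺ (λ f → sides f ℕ.≟ 3) (∈-allFin _)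

      ends⊆triangles : All (_∈ triangles) (d ∷ c ∷ ends)
      ends⊆triangles = ∈triangles td ∷ ∈triangles tc ∷ ∈triangles (fixed⇒triangle (proj₁ ff₀))
        ∷ ∈triangles (fixed⇒triangle (proj₁ ff₁)) ∷ ∈triangles (fixed⇒triangle (proj₁ ff₂)) ∷ []

      ∈targets : d ∈ c ∷ ends
      ∈targets with any? (d Fin.≟_) (c ∷ ends)
      ... | yes d∈ = d∈
      -- Otherwise `d`, `c` and the three ends would be five distinct triangles.
      ... | no d∉ = contradiction
        (subst (5 ≤_) four-triangles
          (unique⊆⇒length≤ (¬Any⇒All¬ _ d∉ ∷ ends-distinct) (All.lookup ends⊆triangles))) 1+n≰n

      find : d ∈ c ∷ ends → PseudoRoad T c d
      find (here d≡c) = contradiction (sym d≡c) c≢d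
      find (there (here refl)) = road₀
      find (there (there (here refl))) = road₁
      find (there (there (there (here refl)))) = road₂

    distinct⇒road : ∀ {c d} → IsTriangle c → IsTriangle d → c ≢ d → PseudoRoad T c d
    distinct⇒road {c} tc td c≢d with IsOrbitMap.surjective face-orbits c
    ... | d₀ , refl = firstFixed⇒roads tc (proj₂ (firstFixed (triangle⇒fixed tc))) td c≢d

proposition8p4 : (T : Trihex) → Tight T → curvatureGraph T ≅ complete 4
proposition8p4 T tight = record
  { bijection = bijection
  ; adjacency = λ (c , tc) (d , td) → mk⇔
      (λ road eq → road⇒≢ road tc td (cong proj₁ (to-injective eq)))
      (λ c≢d → distinct⇒road tight tc td λ c≡d → c≢d (cong (Inverse.to bijection) (≡-Σ c≡d)))
  }
  where
  open Trihex T
  open TrihexProperties T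
  bijection : Σ Face IsTriangle ↔ Fin 4
  bijection = subst (λ n → Σ Face IsTriangle ↔ Fin n) four-triangles (Σ↔Fin (λ f → sides f ℕ.≟ 3) ≡-irrelevant)
  to-injective : ∀ {x y} → Inverse.to bijection x ≡ Inverse.to bijection y → x ≡ y
  to-injective = Injection.injective (↔⇒↣ bijection)
  ≡-Σ : ∀ {c d} {tc : IsTriangle c} {td : IsTriangle d} → c ≡ d → (c , tc) ≡ (d , td)
  ≡-Σ refl = cong (_ ,_) (≡-irrelevant _ _)
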